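{- Let $X$ be an infinite set, $\mathscr{L}$ a relational language, $\kappa$ an infinite ordinal, and let $\mu$ be a probability $\kappa$-measure on $\mathrm{Str}^\kappa_{\mathscr{L}}(X)$. Then $\mathcal{O}^+(\mu)$ has the countable chain condition.
   Context: $\mathrm{Str}_{\mathscr{L}}(X)$ is the set of $\mathscr{L}$-structures with underlying set $X$. An $\mathscr{L}$-literal is an atomic formula or a (possibly iterated) negation of one. $\sigma_\kappa(\mathrm{Str}_{\mathscr{L}}(X))$ is the smallest family of subsets of $\mathrm{Str}_{\mathscr{L}}(X)$ closed under complements and under unions of size $\le\kappa$ and containing all sets $\{\mathcal{M}:\mathcal{M}\models\varphi(\bar a)\}$ for $\varphi$ a literal and $\bar a$ a tuple from $X$. $\mathrm{Str}^\kappa_{\mathscr{L}}(X)$ is $\mathrm{Str}_{\mathscr{L}}(X)$ with this family of measurable sets. A probability $\kappa$-measure on it is a probability measure $\mu$ with $\mu(\bigcup_{i\in\kappa}A_i)=\sum_{i\in\kappa}\mu(A_i)$ for pairwise disjoint measurable $A_i$. The set $\mathbb{B}^\kappa_{\mathscr{L}:X}$ of $\kappa$-Borel codes is the smallest set containing the basic codes $\langle 0,\varphi,\bar a\rangle$ ($\varphi$ a finite conjunction of $\mathscr{L}$-literals, $\bar a$ a tuple from $X$) and closed under formal negation $\neg\gamma$ and formal $\bigvee\Gamma$, $\bigwedge\Gamma$ for $\Gamma=\{\gamma_i\}_{i\in\kappa}$. The interpretation $\mathrm{Int}(\gamma)\subseteq\mathrm{Str}_{\mathscr{L}}(X)$ interprets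 basic codes as $\{\mathcal{M}:\mathcal{M}\models\varphi(\bar a)\}$ and $\neg,\bigvee,\bigwedge$ as complement, union, intersection. $\mu(\gamma)=\mu(\mathrm{Int}(\gamma))$. $\gamma\preceq_\mu\zeta$ means $\mu(\gamma\wedge\neg\zeta)=0$, and $\mathcal{O}^+(\mu)=(\{\gamma\in\mathbb{B}^\kappa_{\mathscr{L}:X}:\mu(\gamma)>0\},\preceq_\mu)$, a pre-order used as a forcing notion (smaller is stronger). Two elements are incompatible if no element of $\mathcal{O}^+(\mu)$ is below both; the countable chain condition says every set of pairwise incompatible elements is countable. -}

module Defs where

open import Axiom.ExcludedMiddle using (ExcludedMiddle)
open import Data.Bool.Base using (Bool; true; false; if_then_else_)
open import Data.Empty using (⊥-elim)
import Data.Empty.Polymorphic as Poly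
open import Data.Fin.Base using (Fin; zero)
open import Data.List.Base using (List; []; _∷_; foldr; map)
open import Data.List.Relation.Unary.All using (All; []; _∷_)
open import Data.List.Relation.Unary.Unique.Propositional using (Unique)
open import Data.Nat.Base using (ℕ)
open import Data.Product.Base using (∃; ∃₂; _×_; _,_; proj₁; proj₂)
open import Data.Rational.Base as ℚ using (ℚ; 0ℚ; 1ℚ)
import Data.Rational.Properties as ℚ
open import Data.Vec.Base using (Vec; lookup)
import Data.Vec.Base as Vec
open import Function.Bundles using (Injection; _↣_; _↔_; mk↣; mk↔ₛ′)
open import Induction.WellFounded using (WellFounded)
open import Level using (Level; 0ℓ; Lift; lift; suc)
open import Relation.Binary.Bundles using (Setoid)
open import Relation.Binary.Core using (Rel)
open import Relation.Binary.Definitions using (tri<; tri≈; tri>)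
open import Relation.Binary.PropositionalEquality
  using (_≡_; _≢_; refl; sym; trans; cong; subst)
import Relation.Binary.PropositionalEquality.Properties as ≡
import Relation.Binary.Construct.On as On
open import Relation.Binary.Structures using (IsStrictTotalOrder)
open import Relation.Nullary using (¬_; does)
open import Relation.Nullary.Decidable using (decidable-stable)
open import Relation.Unary
  using (Pred; Universal; _∈_; _∉_; _⊆_; _⊂_; _≐_; _⊥_; ∁; _∩_; ⋃; ⋂)

private variable
  a b r ℓ : Level

------------------------------------------------------------------------
-- Real numbers

-- Lower cuts: proper nonempty initial segments of ℚ without a greatest
-- element.  Under excluded middle these form the complete ordered field.

record ℝ : Set₁ where
  field
    Cut       : Pred ℚ 0ℓ
    nonempty  : ∃ λ p → p ∈ Cut
    proper    : ∃ λ p → p ∉ Cut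
    downwards : ∀ {p q} → q ℚ.< p → p ∈ Cut → q ∈ Cut
    rounded   : ∀ {p} → p ∈ Cut → ∃ λ q → p ℚ.< q × q ∈ Cut

open ℝ using (Cut)

infix  4 _≤ᵣ_ _<ᵣ_ _≃ᵣ_
infixl 6 _+ᵣ_

_≤ᵣ_ _<ᵣ_ _≃ᵣ_ : Rel ℝ 0ℓ
x ≤ᵣ y = Cut x ⊆ Cut y
x <ᵣ y = Cut x ⊂ Cut y
x ≃ᵣ y = Cut x ≐ Cut y

private
  p-1<p : ∀ p → p ℚ.- 1ℚ ℚ.< p
  p-1<p p = subst (p ℚ.- 1ℚ ℚ.<_) (ℚ.+-identityʳ p)
              (ℚ.+-monoʳ-< p (ℚ.negative⁻¹ (ℚ.- 1ℚ)))

  r-q+q : ∀ r q → (r ℚ.- q) ℚ.+ q ≡ r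
  r-q+q r q = trans (ℚ.+-assoc r (ℚ.- q) q)
                (trans (cong (r ℚ.+_) (ℚ.+-inverseˡ q)) (ℚ.+-identityʳ r))

  p+q-q : ∀ p q → (p ℚ.+ q) ℚ.- q ≡ p
  p+q-q p q = trans (ℚ.+-assoc p q (ℚ.- q))
                (trans (cong (p ℚ.+_) (ℚ.+-inverseʳ q)) (ℚ.+-identityʳ p))

  below : ∀ (x : ℝ) {p u} → p ∈ Cut x → u ∉ Cut x → p ℚ.< u
  below x {p} {u} p∈x u∉x with ℚ.<-cmp p u
  ... | tri< p<u _ _    = p<u
  ... | tri≈ _ refl _   = ⊥-elim (u∉x p∈x)
  ... | tri> _ _ u<p    = ⊥-elim (u∉x (ℝ.downwards x u<p p∈x))

fromℚ : ℚ → ℝ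
fromℚ p = record
  { Cut       = ℚ._< p
  ; nonempty  = p ℚ.- 1ℚ , p-1<p p
  ; proper    = p , ℚ.<-irrefl refl
  ; downwards = ℚ.<-trans
  ; rounded   = ℚ.<-dense
  }

0ᵣ 1ᵣ : ℝ
0ᵣ = fromℚ 0ℚ
1ᵣ = fromℚ 1ℚ

_+ᵣ_ : ℝ → ℝ → ℝ
x +ᵣ y = record
  { Cut       = λ s → ∃₂ λ p q → p ∈ Cut x × q ∈ Cut y × s ≡ p ℚ.+ q
  ; nonempty  = let p , p∈x = ℝ.nonempty x ; q , q∈y = ℝ.nonempty y
                in p ℚ.+ q , p , q , p∈x , q∈y , refl
  ; proper    = let u , u∉x = ℝ.proper x ; v , v∉y = ℝ.proper y
                in u ℚ.+ v , λ (p , q , p∈x , q∈y , eq) →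
                     ℚ.<-irrefl (sym eq)
                       (ℚ.+-mono-< (below x p∈x u∉x) (below y q∈y v∉y))
  ; downwards = λ { {_} {s} s<p+q (p , q , p∈x , q∈y , refl) →
                    s ℚ.- q , q ,
                    ℝ.downwards x
                      (subst (s ℚ.- q ℚ.<_) (p+q-q p q)
                        (ℚ.+-monoˡ-< (ℚ.- q) s<p+q)) p∈x ,
                    q∈y , sym (r-q+q s q) }
  ; rounded   = λ { (p , q , p∈x , q∈y , refl) →
                    let p′ , p<p′ , p′∈x = ℝ.rounded x p∈x
                    in p′ ℚ.+ q , ℚ.+-monoˡ-< q p<p′ , p′ , q , p′∈x , q∈y , refl }
  }

-- The sum of a family of nonnegative reals over an arbitrary index set:
-- the least upper bound of the sums over finite sets of indices.

module _ {I : Set a} (f : I → ℝ) where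

  partialSum : List I → ℝ
  partialSum is = foldr _+ᵣ_ 0ᵣ (map f is)

  _IsUpperBound : ℝ → Set a
  y IsUpperBound = ∀ is → Unique is → partialSum is ≤ᵣ y

  IsSum : ℝ → Set (suc 0ℓ Level.⊔ a)
  IsSum x = x IsUpperBound × (∀ y → y IsUpperBound → x ≤ᵣ y)

------------------------------------------------------------------------
-- Infinite sets and ordinals

Finite Infinite : Set a → Set a
Finite A   = ∃ λ n → A ↔ Fin n
Infinite A = ¬ Finite A

-- An ordinal, presented as a well-ordered type.

record Ordinal (ℓ : Level) : Set (suc ℓ) where
  field
    Carrier            : Set ℓ
    _<_                : Rel Carrier ℓ
    isStrictTotalOrder : IsStrictTotalOrder _≡_ _<_
    wellFounded        : WellFounded _<_

  open IsStrictTotalOrder isStrictTotalOrder public using (_≟_)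

distinctElements : ExcludedMiddle ℓ → {A : Set ℓ} → Infinite A →
                   ∃₂ λ (i j : A) → i ≢ j
distinctElements em {A} inf = decidable-stable em λ none →
  let empty : ¬ A
      empty i = inf (1 , mk↔ₛ′ (λ _ → zero) (λ _ → i)
                  (λ { zero → refl ; (Fin.suc ()) })
                  (λ j → decidable-stable em λ i≢j → none (i , j , i≢j)))
  in inf (0 , mk↔ₛ′ (λ i → ⊥-elim (empty i)) (λ ())
                (λ ()) (λ i → ⊥-elim (empty i)))

------------------------------------------------------------------------
-- Relational languages and their structures

record Language (ℓ : Level) : Set (suc ℓ) where
  field
    Symbol : Set ℓ
    arity  : Symbol → ℕ

module _ (L : Language ℓ) where
  open Language L

  -- Literals in the variables indexed by Fin n.

  data Atom (n : ℕ) : Set ℓ where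
    rel : (R : Symbol) → Vec (Fin n) (arity R) → Atom n
    eq  : Fin n → Fin n → Atom n

  data Literal (n : ℕ) : Set ℓ where
    atom : Atom n → Literal n
    neg  : Literal n → Literal n

  Conjunction : ℕ → Set ℓ
  Conjunction n = List (Literal n)

  module _ (X : Set ℓ) where

    Str : Set (suc ℓ)
    Str = (R : Symbol) → Pred (Vec X (arity R)) ℓ

    SatAtom : ∀ {n} → Atom n → Vec X n → Pred Str ℓ
    SatAtom (rel R vs) as M = M R (Vec.map (lookup as) vs)
    SatAtom (eq v w)   as M = lookup as v ≡ lookup as w

    SatLit : ∀ {n} → Literal n → Vec X n → Pred Str ℓ
    SatLit (atom φ) as   = SatAtom φ as
    SatLit (neg φ)  as M = ¬ SatLit φ as M

    SatConj : ∀ {n} → Conjunction n → Vec X n → Pred Str ℓ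
    SatConj φ as M = All (λ l → SatLit l as M) φ

------------------------------------------------------------------------
-- Measurable sets, measures and codes

module _ (X : Set ℓ) (L : Language ℓ) (κ : Ordinal ℓ) where
  open Ordinal κ using (_≟_) renaming (Carrier to K)

  -- σ_κ(Str_L(X)).  The constructor resp only says that membership in
  -- this family depends on the extension of a set of structures.

  data Measurable : Pred (Str L X) ℓ → Set (suc ℓ) where
    literal : ∀ {n} (φ : Literal L n) (as : Vec X n) →
              Measurable (SatLit L X φ as)
    compl   : ∀ {A} → Measurable A → Measurable (∁ A)
    union   : ∀ {I : Set ℓ} → I ↣ K → {A : I → Pred (Str L X) ℓ} →
              (∀ i → Measurable (A i)) → Measurable (⋃ I A)
    resp    : ∀ {A B} → A ≐ B → Measurable A → Measurable B

  record ProbabilityMeasure : Set (suc ℓ) where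
    field
      measure : {A : Pred (Str L X) ℓ} → Measurable A → ℝ

    Additive : Set ℓ → Set (suc ℓ)
    Additive I =
      {A : I → Pred (Str L X) ℓ} (mA : ∀ i → Measurable (A i)) →
      (m⋃A : Measurable (⋃ I A)) →
      (∀ {i j} → i ≢ j → A i ⊥ A j) →
      IsSum (λ i → measure (mA i)) (measure m⋃A)

    field
      measure-cong : ∀ {A B} (mA : Measurable A) (mB : Measurable B) →
                     A ≐ B → measure mA ≃ᵣ measure mB
      nonnegative  : ∀ {A} (mA : Measurable A) → 0ᵣ ≤ᵣ measure mA
      total        : ∀ {A} (mA : Measurable A) → Universal A →
                     measure mA ≃ᵣ 1ᵣ
      σ-additive   : Additive (Lift ℓ ℕ)
      κ-additive   : Additive K

  data Code : Set ℓ where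
    basic : ∀ {n} → Conjunction L n → Vec X n → Code
    ¬ᶜ_   : Code → Code
    ⋁ ⋀   : (K → Code) → Code

  -- Set-theoretic identity of codes: ⋁ and ⋀ are applied to the *set*
  -- {γᵢ : i ∈ κ}, so two families with the same members give the same code.

  infix 4 _≈ᶜ_

  data _≈ᶜ_ : Rel Code ℓ where
    basic : ∀ {n} {φ : Conjunction L n} {as : Vec X n} → basic φ as ≈ᶜ basic φ as
    neg   : ∀ {γ ζ} → γ ≈ᶜ ζ → ¬ᶜ γ ≈ᶜ ¬ᶜ ζ
    ⋁     : ∀ {γ ζ} → (∀ i → ∃ λ j → γ i ≈ᶜ ζ j) →
            (∀ j → ∃ λ i → γ i ≈ᶜ ζ j) → ⋁ γ ≈ᶜ ⋁ ζ
    ⋀     : ∀ {γ ζ} → (∀ i → ∃ λ j → γ i ≈ᶜ ζ j) →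
            (∀ j → ∃ λ i → γ i ≈ᶜ ζ j) → ⋀ γ ≈ᶜ ⋀ ζ

  ≈ᶜ-refl : ∀ {γ} → γ ≈ᶜ γ
  ≈ᶜ-refl {basic φ as} = basic
  ≈ᶜ-refl {¬ᶜ γ}       = neg ≈ᶜ-refl
  ≈ᶜ-refl {⋁ γ}        = ⋁ (λ i → i , ≈ᶜ-refl) (λ i → i , ≈ᶜ-refl)
  ≈ᶜ-refl {⋀ γ}        = ⋀ (λ i → i , ≈ᶜ-refl) (λ i → i , ≈ᶜ-refl)

  ≈ᶜ-sym : ∀ {γ ζ} → γ ≈ᶜ ζ → ζ ≈ᶜ γ
  ≈ᶜ-sym basic   = basic
  ≈ᶜ-sym (neg e) = neg (≈ᶜ-sym e)
  ≈ᶜ-sym (⋁ f g) = ⋁ (λ j → proj₁ (g j) , ≈ᶜ-sym (proj₂ (g j)))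
                     (λ i → proj₁ (f i) , ≈ᶜ-sym (proj₂ (f i)))
  ≈ᶜ-sym (⋀ f g) = ⋀ (λ j → proj₁ (g j) , ≈ᶜ-sym (proj₂ (g j)))
                     (λ i → proj₁ (f i) , ≈ᶜ-sym (proj₂ (f i)))

  ≈ᶜ-trans : ∀ {γ ζ η} → γ ≈ᶜ ζ → ζ ≈ᶜ η → γ ≈ᶜ η
  ≈ᶜ-trans basic   basic     = basic
  ≈ᶜ-trans (neg d) (neg e)   = neg (≈ᶜ-trans d e)
  ≈ᶜ-trans (⋁ f g) (⋁ f′ g′) =
    ⋁ (λ i → let j , d = f i  ; k , e = f′ j in k , ≈ᶜ-trans d e)
      (λ k → let j , e = g′ k ; i , d = g j  in i , ≈ᶜ-trans d e)
  ≈ᶜ-trans (⋀ f g) (⋀ f′ g′) =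
    ⋀ (λ i → let j , d = f i  ; k , e = f′ j in k , ≈ᶜ-trans d e)
      (λ k → let j , e = g′ k ; i , d = g j  in i , ≈ᶜ-trans d e)

  codeSetoid : Setoid ℓ ℓ
  codeSetoid = record
    { Carrier       = Code
    ; _≈_           = _≈ᶜ_
    ; isEquivalence = record { refl = ≈ᶜ-refl ; sym = ≈ᶜ-sym ; trans = ≈ᶜ-trans }
    }

  Int : Code → Pred (Str L X) ℓ
  Int (basic φ as) = SatConj L X φ as
  Int (¬ᶜ γ)       = ∁ (Int γ)
  Int (⋁ γ)        = ⋃ K (λ i → Int (γ i))
  Int (⋀ γ)        = ⋂ K (λ i → Int (γ i))

  -- Excluded middle is the classical metatheory made explicit: intersections
  -- are measurable only as complements of unions of complements.

  module _ (em : ExcludedMiddle ℓ) (inf : Infinite K) where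
    i₀ i₁ : K
    i₀ = proj₁ (distinctElements em inf)
    i₁ = proj₁ (proj₂ (distinctElements em inf))

    i₀≢i₁ : i₀ ≢ i₁
    i₀≢i₁ = proj₂ (proj₂ (distinctElements em inf))

    Bool↣K : Lift ℓ Bool ↣ K
    Bool↣K = mk↣ {to = λ { (lift false) → i₀ ; (lift true) → i₁ }} λ
      { {lift false} {lift false} _ → refl
      ; {lift false} {lift true}  e → ⊥-elim (i₀≢i₁ e)
      ; {lift true}  {lift false} e → ⊥-elim (i₀≢i₁ (sym e))
      ; {lift true}  {lift true}  _ → refl
      }

    id↣ : K ↣ K
    id↣ = mk↣ {to = λ i → i} λ e → e

    measurable-⋂ : ∀ {I : Set ℓ} → I ↣ K → {A : I → Pred (Str L X) ℓ} →
                   (∀ i → Measurable (A i)) → Measurable (⋂ I A)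
    measurable-⋂ I↣K mA = resp
      ( (λ ¬∃ i → decidable-stable em λ ¬Ai → ¬∃ (i , ¬Ai))
      , (λ all (i , ¬Ai) → ¬Ai (all i)))
      (compl (union I↣K (λ i → compl (mA i))))

    measurable-SatConj : ∀ {n} (φ : Conjunction L n) (as : Vec X n) →
                         Measurable (SatConj L X φ as)
    measurable-SatConj []      as = resp
      ((λ _ → []) , (λ _ ()))
      (measurable-⋂ {I = Poly.⊥}
        (mk↣ {to = λ ()} λ { {()} }) {A = λ ()} λ ())
    measurable-SatConj (l ∷ φ) as = resp
      ( (λ h → h (lift false) ∷ h (lift true))
      , (λ { (p ∷ ps) (lift false) → p ; (p ∷ ps) (lift true) → ps }))
      (measurable-⋂ Bool↣K
        {A = λ { (lift false) → SatLit L X l as ; (lift true) → SatConj L X φ as }}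
        (λ { (lift false) → literal l as ; (lift true) → measurable-SatConj φ as }))

    measurable-Int : ∀ γ → Measurable (Int γ)
    measurable-Int (basic φ as) = measurable-SatConj φ as
    measurable-Int (¬ᶜ γ)       = compl (measurable-Int γ)
    measurable-Int (⋁ γ)        = union id↣ (λ i → measurable-Int (γ i))
    measurable-Int (⋀ γ)        = measurable-⋂ id↣ (λ i → measurable-Int (γ i))

    -- γ ∧ᶜ ζ is ⋀ {γ, ζ}, the set {γ, ζ} being enumerated along κ; up to ≈ᶜ
    -- the choice of the index i₀ is irrelevant.

    infixr 6 _∧ᶜ_

    _∧ᶜ_ : Code → Code → Code
    γ ∧ᶜ ζ = ⋀ λ i → if does (i ≟ i₀) then γ else ζ

    module _ (μ : ProbabilityMeasure) where
      open ProbabilityMeasure μ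

      ⟦_⟧ : Code → ℝ
      ⟦ γ ⟧ = measure (measurable-Int γ)

      -- The underlying set of O⁺(μ); its equality ignores the positivity proof.

      O⁺ : Setoid ℓ ℓ
      O⁺ = On.setoid codeSetoid (proj₁ {A = Code} {B = λ γ → 0ᵣ <ᵣ ⟦ γ ⟧})

      Below : Rel (Setoid.Carrier O⁺) 0ℓ
      Below (γ , _) (ζ , _) = ⟦ γ ∧ᶜ ¬ᶜ ζ ⟧ ≃ᵣ 0ᵣ

------------------------------------------------------------------------
-- The countable chain condition

module _ (P : Setoid a ℓ) where
  open Setoid P using (Carrier; _≈_)

  subsetoid : Pred Carrier b → Setoid _ _
  subsetoid S = On.setoid P (proj₁ {A = Carrier} {B = S})

  Countable : Pred Carrier b → Set _
  Countable S = Injection (subsetoid S) (≡.setoid ℕ)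

  module _ (_≼_ : Rel Carrier r) where

    Incompatible : Rel Carrier _
    Incompatible p q = ¬ ∃ λ s → s ≼ p × s ≼ q

    PairwiseIncompatible : Pred Carrier b → Set _
    PairwiseIncompatible S =
      ∀ {p q} → p ∈ S → q ∈ S → ¬ p ≈ q → Incompatible p q

    CountableChainCondition : (b : Level) → Set _
    CountableChainCondition b =
      (S : Pred Carrier b) → PairwiseIncompatible S → Countable S

{-# OPTIONS --safe #-}
module Submission where

-- An antichain has fewer than n + 2 elements of measure > 1/(n+1): its members
-- overlap in null sets, since a non-null intersection would be a common
-- extension.  So it is a countable union of finite sets.  The choice of an
-- enumeration for each of these comes from excluded middle, which decides
-- types rather than mere propositions.

open import Defs
open import Axiom.ExcludedMiddle using (ExcludedMiddle)
open import Level using (Level; 0ℓ; Lift; lift; suc)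

open import Algebra.Definitions.RawMonoid using () renaming (_×_ to multiple)
open import Data.Bool.Base using (Bool; true; false)
import Data.Empty.Polymorphic as Poly
open import Data.Fin.Base using (Fin; toℕ)
open import Data.Fin.Properties using (toℕ-injective)
open import Data.Integer.Base as ℤ using (+_; +[1+_])
import Data.Integer.Properties as ℤ
import Data.Integer.Solver as ℤ
open import Data.List.Base using (List; []; _∷_; length; lookup)
open import Data.List.Relation.Unary.All as All using (All; []; _∷_)
open import Data.List.Relation.Unary.All.Properties using (¬Any⇒All¬)
open import Data.List.Relation.Unary.AllPairs as AllPairs using (AllPairs; []; _∷_)
open import Data.List.Relation.Unary.Any as Any using (Any)
open import Data.List.Relation.Unary.Any.Properties using (lookup-index)
open import Data.List.Relation.Unary.Unique.Propositional using (Unique)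
open import Data.Nat.Base as ℕ using (ℕ; zero) renaming (suc to 1+)
open import Data.Nat.Coprimality using (1-coprimeTo)
import Data.Nat.Properties as ℕ
open import Data.Product.Base using (∃; _×_; _,_; proj₁; proj₂)
open import Data.Rational.Base as ℚ using (ℚ; mkℚ; 0ℚ; 1ℚ; toℚᵘ)
import Data.Rational.Properties as ℚ
open import Data.Rational.Unnormalised.Base as ℚᵘ using (mkℚᵘ; *≡*)
import Data.Rational.Unnormalised.Properties as ℚᵘ
open import Data.Sum.Base using (inj₁; inj₂)
open import Function.Base using (_∘_; id)
open import Function.Bundles using (Injection; mk↣)
open import Relation.Binary.Bundles using (Setoid)
open import Relation.Binary.PropositionalEquality
  using (_≡_; _≢_; refl; sym; trans; cong; subst)
import Relation.Binary.PropositionalEquality.Properties as ≡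
open import Relation.Nullary using (¬_; yes; no; contradiction)
open import Relation.Nullary.Decidable using (decidable-stable)
open import Relation.Unary
  using (Pred; Empty; _∈_; _⊆_; _≐_; _⊥_; ∁; _∩_; _∪_; _∖_; ⋃)

open ℝ using (Cut)

private variable
  a b ℓ : Level

-- Rational multiples and unit fractions

infixr 8 _·_

_·_ : ℕ → ℚ → ℚ
_·_ = multiple ℚ.+-0-rawMonoid

unitFraction : ℕ → ℚ
unitFraction n = mkℚ (+ 1) n (1-coprimeTo (1+ n))

unitFraction-positive : ∀ n → 0ℚ ℚ.< unitFraction n
unitFraction-positive n = ℚ.positive⁻¹ (unitFraction n)

-- The fraction with numerator `k` and denominator `n + 1` need not be in lowest terms, so the
-- induction runs in the unnormalised rationals, where it can be written down as it stands.
toℚᵘ-·-unitFraction : ∀ n k → toℚᵘ (k · unitFraction n) ℚᵘ.≃ mkℚᵘ (+ k) n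
toℚᵘ-·-unitFraction n zero   = *≡* refl
toℚᵘ-·-unitFraction n (1+ k) = ℚᵘ.≃-trans
  (ℚ.toℚᵘ-homo-+ (unitFraction n) (k · unitFraction n))
  (ℚᵘ.≃-trans (ℚᵘ.+-congʳ (mkℚᵘ (+ 1) n) (toℚᵘ-·-unitFraction n k))
    (*≡* (solve 2 (λ k d → (con (+ 1) :* d :+ k :* d) :* d
                           := (con (+ 1) :+ k) :* (d :* d)) refl (+ k) (+ 1+ n))))
  where open ℤ.+-*-Solver

n·unitFraction≡1 : ∀ n → 1+ n · unitFraction n ≡ 1ℚ
n·unitFraction≡1 n = ℚ.toℚᵘ-injective (ℚᵘ.≃-trans (toℚᵘ-·-unitFraction n (1+ n))
  (*≡* (ℤ.*-comm (+ 1+ n) (+ 1))))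

-- A positive numerator is at least 1, so the denominator of `p` itself serves; `d` is that
-- denominator minus one.
unitFraction≤ : ∀ {p} → 0ℚ ℚ.< p → ∃ λ n → unitFraction n ℚ.≤ p
unitFraction≤ {mkℚ +[1+ m ] d _} _ =
  d , ℚ.*≤* (ℤ.*-monoʳ-≤-nonNeg (+ 1+ d) (ℤ.+≤+ {n = 1+ m} (ℕ.s≤s ℕ.z≤n)))
unitFraction≤ {mkℚ (+ zero) d _} (ℚ.*<* 0<0) = contradiction 0<0 λ { (ℤ.+<+ ()) }
unitFraction≤ {mkℚ ℤ.-[1+ m ] d _} (ℚ.*<* 0<-) = contradiction 0<- λ ()

p-q+q≡p : ∀ p q → (p ℚ.- q) ℚ.+ q ≡ p
p-q+q≡p p q = trans (ℚ.+-assoc p (ℚ.- q) q)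
  (trans (cong (p ℚ.+_) (ℚ.+-inverseˡ q)) (ℚ.+-identityʳ p))

p+[q-p]≡q : ∀ p q → p ℚ.+ (q ℚ.- p) ≡ q
p+[q-p]≡q p q = trans (ℚ.+-comm p (q ℚ.- p)) (p-q+q≡p q p)

p-q<r : ∀ {p q r} → p ℚ.< q ℚ.+ r → p ℚ.- q ℚ.< r
p-q<r {p} {q} {r} p<q+r = subst (p ℚ.- q ℚ.<_)
  (trans (cong (ℚ._- q) (ℚ.+-comm q r))
    (trans (ℚ.+-assoc r q (ℚ.- q))
      (trans (cong (r ℚ.+_) (ℚ.+-inverseʳ q)) (ℚ.+-identityʳ r))))
  (ℚ.+-monoˡ-< (ℚ.- q) p<q+r)

p<q⇒p-q<0 : ∀ {p q} → p ℚ.< q → p ℚ.- q ℚ.< 0ℚ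
p<q⇒p-q<0 {p} {q} p<q = p-q<r (subst (p ℚ.<_) (sym (ℚ.+-identityʳ q)) p<q)

q<0⇒p+q<p : ∀ {p q} → q ℚ.< 0ℚ → p ℚ.+ q ℚ.< p
q<0⇒p+q<p {p} {q} q<0 = subst (p ℚ.+ q ℚ.<_) (ℚ.+-identityʳ p) (ℚ.+-monoʳ-< p q<0)

-- Lower cuts

x+y≤x : ∀ x y → y ≤ᵣ 0ᵣ → x +ᵣ y ≤ᵣ x
x+y≤x x y y≤0 (p , q , p∈x , q∈y , refl) =
  ℝ.downwards x (q<0⇒p+q<p (y≤0 q∈y)) p∈x

x+y≤y : ∀ x y → x ≤ᵣ 0ᵣ → x +ᵣ y ≤ᵣ y
x+y≤y x y x≤0 (p , q , p∈x , q∈y , refl) =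
  ℝ.downwards y (subst (ℚ._< q) (ℚ.+-comm q p) (q<0⇒p+q<p (x≤0 p∈x))) q∈y

-- Zero is not in its own cut, so `p` cannot be split as `p + 0`. Roundedness gives a larger member
-- `q`, and `p - q` is negative.
x≤x+0 : ∀ x → x ≤ᵣ x +ᵣ 0ᵣ
x≤x+0 x {p} p∈x = let q , p<q , q∈x = ℝ.rounded x p∈x in
  q , p ℚ.- q , q∈x , p<q⇒p-q<0 p<q , sym (p+[q-p]≡q q p)

+ᵣ-monoʳ-≤ : ∀ x {y z} → y ≤ᵣ z → x +ᵣ y ≤ᵣ x +ᵣ z
+ᵣ-monoʳ-≤ x y≤z (p , q , p∈x , q∈y , e) = p , q , p∈x , y≤z q∈y , e

x≤x+y : ∀ x y → 0ᵣ ≤ᵣ y → x ≤ᵣ x +ᵣ y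
x≤x+y x y 0≤y p∈x = +ᵣ-monoʳ-≤ x {0ᵣ} {y} 0≤y (x≤x+0 x p∈x)

1+x≤1⇒x≤0 : ∀ x → 1ᵣ +ᵣ x ≤ᵣ 1ᵣ → x ≤ᵣ 0ᵣ
1+x≤1⇒x≤0 x 1+x≤1 {q} q∈x with q ℚ.<? 0ℚ
... | yes q<0 = q<0
... | no  q≮0 = let q′ , q<q′ , q′∈x = ℝ.rounded x q∈x
                    -- A positive member `q′` of `x` puts 1 into the cut of the sum, as
                    -- `(1 - q′) + q′`; the assumption then gives 1 < 1.
                    0<q′ = ℚ.≤-<-trans (ℚ.≮⇒≥ q≮0) q<q′
  in contradiction
    (1+x≤1 (1ℚ ℚ.- q′ , q′ ,
      p-q<r {1ℚ} {q′} {1ℚ} (subst (ℚ._< q′ ℚ.+ 1ℚ) (ℚ.+-identityˡ 1ℚ) (ℚ.+-monoˡ-< 1ℚ 0<q′)) ,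
      q′∈x , sym (p-q+q≡p 1ℚ q′)))
    (ℚ.<-irrefl refl)

module _ {I : Set a} (f : I → ℝ) where

  partialSum≤0 : ∀ {is} → All (λ i → f i ≤ᵣ 0ᵣ) is → partialSum f is ≤ᵣ 0ᵣ
  partialSum≤0 []            = id
  partialSum≤0 {i ∷ is} (h ∷ hs) =
    partialSum≤0 hs ∘ x+y≤y (f i) (partialSum f is) h

  -- A list without repetitions counts `f i` at most once, and every other term is at most zero. The
  -- sum over the empty list is where `0ᵣ ≤ᵣ f i` enters.
  partialSum≤ : ExcludedMiddle a → ∀ i → 0ᵣ ≤ᵣ f i → (∀ j → i ≢ j → f j ≤ᵣ 0ᵣ) →
                ∀ is → Unique is → partialSum f is ≤ᵣ f i
  partialSum≤ em i 0≤fi rest [] _ = 0≤fi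
  partialSum≤ em i 0≤fi rest (j ∷ js) (j∉js ∷ u) with em {i ≡ j}
  ... | yes refl = x+y≤x (f i) (partialSum f js)
                     (partialSum≤0 (All.map (rest _) j∉js))
  ... | no i≢j   = partialSum≤ em i 0≤fi rest js u
                 ∘ x+y≤y (f j) (partialSum f js) (rest j i≢j)

-- Countability of a union of finite sets

-- Cantor's enumeration: the antidiagonal of sum `s` is walked from `(s , 0)` to `(0 , s)`, then the
-- next one begins.
diagonal : ℕ → ℕ × ℕ
diagonal zero   = 0 , 0
diagonal (1+ k) with diagonal k
... | zero , j = 1+ j , 0
... | 1+ i , j = i , 1+ j

diagonal-surjective : ∀ i j → ∃ λ k → diagonal k ≡ (i , j)
diagonal-surjective i j = onDiagonal (i ℕ.+ j) i j refl
  where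
  -- The walk is run backwards: `(i , 1+ j)` is preceded by `(1+ i , j)`, and `(1+ i , 0)` by
  -- `(0 , i)` on the previous antidiagonal. The recursion is lexicographic in `s` and `j`.
  onDiagonal : ∀ s i j → i ℕ.+ j ≡ s → ∃ λ k → diagonal k ≡ (i , j)
  onDiagonal s i (1+ j) e with onDiagonal s (1+ i) j (trans (sym (ℕ.+-suc i j)) e)
  ... | k , eₖ = 1+ k , lemma
    where
    lemma : diagonal (1+ k) ≡ (i , 1+ j)
    lemma rewrite eₖ = refl
  onDiagonal zero zero zero e = 0 , refl
  onDiagonal (1+ s) (1+ i) zero e
    with onDiagonal s 0 i (trans (sym (ℕ.+-identityʳ i)) (ℕ.suc-injective e))
  ... | k , eₖ = 1+ k , lemma
    where
    lemma : diagonal (1+ k) ≡ (1+ i , 0)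
    lemma rewrite eₖ = refl

leastWitness : ExcludedMiddle ℓ → {P : Pred ℕ ℓ} → ∀ n → P n →
               ∃ λ m → P m × (∀ {k} → P k → m ℕ.≤ k)
leastWitness em zero p = zero , p , λ _ → ℕ.z≤n
leastWitness em {P} (1+ n) p with em {P 0}
... | yes p₀ = zero , p₀ , λ _ → ℕ.z≤n
... | no ¬p₀ with leastWitness em {P ∘ 1+} n p
...   | m , pₘ , least = 1+ m , pₘ , λ
        { {zero} p₀ → contradiction p₀ ¬p₀ ; {1+ k} pₖ → ℕ.s≤s (least pₖ) }

module _ (em : ∀ {a} → ExcludedMiddle a) (P : Setoid a ℓ) where
  open Setoid P using (Carrier; _≈_; _≉_) renaming (sym to ≈-sym; trans to ≈-trans)

  -- An element may have many indices. Its least one depends only on its class, because `R` respects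
  -- `≈`, so taking the least turns the relation into a function of setoids; `unique` makes it
  -- injective.
  indexed⇒countable : (R : ℕ → Pred Carrier ℓ) →
    (∀ {k p q} → R k p → R k q → p ≈ q) →
    (∀ {k p q} → p ≈ q → R k p → R k q) →
    (∀ p → ∃ λ k → R k p) →
    Injection P (≡.setoid ℕ)
  indexed⇒countable R unique respects total = record
    { to        = index
    ; cong      = λ {p} {q} p≈q → ℕ.≤-antisym
        (index-least p (respects (≈-sym p≈q) (index-R q)))
        (index-least q (respects p≈q (index-R p)))
    ; injective = λ {p} {q} e → unique (index-R p)
        (subst (λ k → R k q) (sym e) (index-R q))
    }
    where
    first : ∀ p → ∃ λ k → R k p × (∀ {j} → R j p → k ℕ.≤ j)
    first p = let k , r = total p in leastWitness em {λ j → R j p} k r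

    index : Carrier → ℕ
    index p = proj₁ (first p)

    index-R : ∀ p → R (index p) p
    index-R p = proj₁ (proj₂ (first p))

    index-least : ∀ p {j} → R j p → index p ℕ.≤ j
    index-least p = proj₂ (proj₂ (first p))

  module _ (Q : Pred Carrier b) (n : ℕ)
    (bounded : ∀ {xs} → AllPairs _≉_ xs → All Q xs → length xs ≢ n) where

    -- A list of pairwise inequivalent members is extended greedily. It grows by one at a time, so
    -- forbidding the single length `n` forces it to stop, and then every member is equivalent to a
    -- listed one.
    representatives : ∃ λ xs → ∀ {p} → Q p → Any (_≈ p) xs
    representatives = extend n [] [] [] (ℕ.+-identityʳ n)
      where
      -- `m` is the number of members still to be added before the forbidden length is reached.
      extend : ∀ m xs → AllPairs _≉_ xs → All Q xs → m ℕ.+ length xs ≡ n →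
               ∃ λ ys → ∀ {p} → Q p → Any (_≈ p) ys
      extend zero xs distinct qs e = contradiction e (bounded distinct qs)
      extend (1+ m) xs distinct qs e with em {_} {∃ λ p → Q p × All (p ≉_) xs}
      ... | yes (p , q , new) =
        extend m (p ∷ xs) (new ∷ distinct) (q ∷ qs) (trans (ℕ.+-suc m (length xs)) e)
      ... | no none = xs , λ {p} q → decidable-stable em λ old →
        none (p , q , All.map (_∘ ≈-sym) (¬Any⇒All¬ xs old))

  -- An element is coded by a layer containing it and the position of its representative there, the
  -- pair being packed by `diagonal`. Layers may overlap, so an element can have several codes.
  boundedLayers⇒countable : (Q : ℕ → Pred Carrier b) (size : ℕ → ℕ) →
    (∀ n {xs} → AllPairs _≉_ xs → All (Q n) xs → length xs ≢ size n) →
    (∀ p → ∃ λ n → Q n p) →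
    Injection P (≡.setoid ℕ)
  boundedLayers⇒countable Q size bounded covered =
    indexed⇒countable (R ∘ diagonal)
      (λ {k} (i , eᵢ , xᵢ≈p) (j , eⱼ , xⱼ≈q) →
        ≈-trans (≈-sym xᵢ≈p) (subst (λ i → lookup (xs (proj₁ (diagonal k))) i ≈ _)
          (toℕ-injective (trans eⱼ (sym eᵢ))) xⱼ≈q))
      (λ { p≈q (i , e , xᵢ≈p) → i , e , ≈-trans xᵢ≈p p≈q })
      λ p → let n , q   = covered p
                found   = proj₂ (reps n) q
                k , e  = diagonal-surjective n (toℕ (Any.index found))
            in k , subst (λ ij → R ij p) (sym e)
                     (Any.index found , refl , lookup-index found)
    where
    reps : ∀ n → ∃ λ xs → ∀ {p} → Q n p → Any (_≈ p) xs
    reps n = representatives (Q n) (size n) (bounded n)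

    xs : ℕ → List Carrier
    xs n = proj₁ (reps n)

    -- Positions are natural numbers compared through `toℕ`, so every pair is a code; one beyond the
    -- end of the list codes nothing.
    R : ℕ × ℕ → Pred Carrier ℓ
    R (n , i) p = ∃ λ (j : Fin (length (xs n))) → toℕ j ≡ i × lookup (xs n) j ≈ p

-- Measures

module _ (em : ∀ {a} → ExcludedMiddle a) (X : Set ℓ) (L : Language ℓ)
         (κ : Ordinal ℓ) (inf : Infinite (Ordinal.Carrier κ)) where

  private
    Event : Set (suc ℓ)
    Event = Pred (Str L X) ℓ

    Meas : Event → Set (suc ℓ)
    Meas = Measurable X L κ

    -- Written as an empty union, so that `union` applies to it directly.
    ∅ : Event
    ∅ = ⋃ {ℓ = ℓ} (Poly.⊥ {ℓ}) λ ()

    variable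
      A B : Event

  measurable-∅ : Meas ∅
  measurable-∅ = union (mk↣ {to = λ ()} λ { {()} }) λ ()

  private
    choose : Event → Event → Lift ℓ Bool → Event
    choose A B (lift false) = A
    choose A B (lift true)  = B

    measurable-choose : Meas A → Meas B → ∀ i → Meas (choose A B i)
    measurable-choose mA mB (lift false) = mA
    measurable-choose mA mB (lift true)  = mB

  measurable-∪ : Meas A → Meas B → Meas (A ∪ B)
  measurable-∪ {A} {B} mA mB = resp
    ( (λ { (lift false , x) → inj₁ x ; (lift true , x) → inj₂ x })
    , (λ { (inj₁ x) → lift false , x ; (inj₂ x) → lift true , x }))
    (union (Bool↣K X L κ em inf) {choose A B} (measurable-choose mA mB))

  measurable-∩ : Meas A → Meas B → Meas (A ∩ B)
  measurable-∩ {A} {B} mA mB = resp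
    ( (λ h → h (lift false) , h (lift true))
    , (λ { (x , y) (lift false) → x ; (x , y) (lift true) → y }))
    (measurable-⋂ X L κ em inf (Bool↣K X L κ em inf) {choose A B}
      (measurable-choose mA mB))

  measurable-∖ : Meas A → Meas B → Meas (A ∖ B)
  measurable-∖ mA mB = measurable-∩ mA (compl mB)

  module _ (μ : ProbabilityMeasure X L κ) where
    open ProbabilityMeasure μ

    private
      -- Countable additivity speaks of sequences, so two events are continued by empty ones to
      -- obtain additivity for a pair.
      padded : Event → Event → Lift ℓ ℕ → Event
      padded A B (lift 0)           = A
      padded A B (lift 1)           = B
      padded A B (lift (1+ (1+ _))) = ∅

      measurable-padded : Meas A → Meas B → ∀ i → Meas (padded A B i)
      measurable-padded mA mB (lift 0)           = mA
      measurable-padded mA mB (lift 1)           = mB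
      measurable-padded mA mB (lift (1+ (1+ _))) = measurable-∅

      ⋃-padded : A ∪ B ≐ ⋃ (Lift ℓ ℕ) (padded A B)
      ⋃-padded =
        (λ { (inj₁ x) → lift 0 , x ; (inj₂ x) → lift 1 , x }) ,
        (λ { (lift 0 , x) → inj₁ x ; (lift 1 , x) → inj₂ x
           ; (lift (1+ (1+ _)) , () , _) })

      padded-disjoint : A ⊥ B → ∀ {i j} → i ≢ j → padded A B i ⊥ padded A B j
      padded-disjoint d {lift 0} {lift 0} i≢j _ = contradiction refl i≢j
      padded-disjoint d {lift 0} {lift 1} _ xy  = d xy
      padded-disjoint d {lift 1} {lift 0} _ (x , y) = d (y , x)
      padded-disjoint d {lift 1} {lift 1} i≢j _ = contradiction refl i≢j
      padded-disjoint d {lift (1+ (1+ _))} _ ((() , _) , _)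
      padded-disjoint d {lift 0} {lift (1+ (1+ _))} _ (_ , () , _)
      padded-disjoint d {lift 1} {lift (1+ (1+ _))} _ (_ , () , _)

      binarySum : (mA : Meas A) (mB : Meas B) (m∪ : Meas (A ∪ B)) → A ⊥ B →
                  IsSum (λ i → measure (measurable-padded mA mB i))
                        (measure (resp ⋃-padded m∪))
      binarySum mA mB m∪ d =
        σ-additive (measurable-padded mA mB) (resp ⋃-padded m∪) (padded-disjoint d)

    -- This is the upper bound half of the sum, at the list of the first two indices. The measure of
    -- `∅` does not enter, so `empty⇒null` can rest on it without circularity.
    measure-superadditive : (mA : Meas A) (mB : Meas B) (m∪ : Meas (A ∪ B)) → A ⊥ B →
                            measure mA +ᵣ measure mB ≤ᵣ measure m∪
    measure-superadditive mA mB m∪ d =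
      proj₂ (measure-cong m∪ (resp ⋃-padded m∪) ⋃-padded)
      ∘ proj₁ (binarySum mA mB m∪ d) (lift 0 ∷ lift 1 ∷ [])
          (((λ ()) ∷ []) ∷ [] ∷ [])
      ∘ +ᵣ-monoʳ-≤ (measure mA) {measure mB} {measure mB +ᵣ 0ᵣ} (x≤x+0 (measure mB))

    -- Both `∁ A` and `∁ A ∪ A` are the whole space, so superadditivity gives `1 + μ(A) ≤ 1`, and 1
    -- cancels.
    empty⇒null : (mA : Meas A) → Empty A → measure mA ≤ᵣ 0ᵣ
    empty⇒null {A} mA empty = 1+x≤1⇒x≤0 (measure mA)
      ( proj₁ (total m∪ λ M → inj₁ (empty M))
      ∘ measure-superadditive (compl mA) mA m∪ (λ (_ , x) → contradiction x (empty _))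
      ∘ λ (p , q , p<1 , q∈ , e) →
          p , q , proj₂ (total (compl mA) empty) p<1 , q∈ , e)
      where
      m∪ : Meas (∁ A ∪ A)
      m∪ = measurable-∪ (compl mA) mA

    measure-mono : (mA : Meas A) (mB : Meas B) → A ⊆ B → measure mA ≤ᵣ measure mB
    measure-mono {A} {B} mA mB A⊆B =
      proj₁ (measure-cong m∪ mB
        ( (λ { (inj₁ x) → A⊆B x ; (inj₂ (x , _)) → x })
        , (λ {M} x → split {M} x)))
      ∘ measure-superadditive mA (measurable-∖ mB mA) m∪ (λ (x , _ , ¬x) →
          contradiction x ¬x)
      ∘ x≤x+y (measure mA) (measure (measurable-∖ mB mA)) (nonnegative _)
      where
      m∪ : Meas (A ∪ (B ∖ A))
      m∪ = measurable-∪ mA (measurable-∖ mB mA)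

      split : B ⊆ A ∪ (B ∖ A)
      split {M} x with em {_} {A M}
      ... | yes y = inj₁ y
      ... | no ¬y = inj₂ (x , ¬y)

    -- This is the least upper bound half of the sum: all terms of the padded sequence but the first
    -- are null, so `measure mA` bounds every partial sum.
    measure-∪-null : (mA : Meas A) (mB : Meas B) (m∪ : Meas (A ∪ B)) → A ⊥ B →
                     measure mB ≤ᵣ 0ᵣ → measure m∪ ≤ᵣ measure mA
    measure-∪-null mA mB m∪ d null =
      proj₂ (binarySum mA mB m∪ d) (measure mA)
        (partialSum≤ _ em (lift 0) (nonnegative mA) λ
          { (lift 0) i≢j         → contradiction refl i≢j
          ; (lift 1) _           → null
          ; (lift (1+ (1+ _))) _ → empty⇒null measurable-∅ λ { _ (() , _) } })
      ∘ proj₁ (measure-cong m∪ (resp ⋃-padded m∪) ⋃-padded)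

    measure-∖-null : (mA : Meas A) (mB : Meas B) → measure (measurable-∩ mA mB) ≤ᵣ 0ᵣ →
                     measure mA ≤ᵣ measure (measurable-∖ mA mB)
    measure-∖-null {A} {B} mA mB null =
      measure-∪-null (measurable-∖ mA mB) (measurable-∩ mA mB) m∪
        (λ ((_ , ¬y) , (_ , y)) → contradiction y ¬y) null
      ∘ measure-mono mA m∪ split
      where
      m∪ : Meas ((A ∖ B) ∪ (A ∩ B))
      m∪ = measurable-∪ (measurable-∖ mA mB) (measurable-∩ mA mB)

      split : A ⊆ (A ∖ B) ∪ (A ∩ B)
      split {M} x with em {_} {B M}
      ... | yes y = inj₂ (x , y)
      ... | no ¬y = inj₁ (x , ¬y)

    null-∪ : (mA : Meas A) (mB : Meas B) (m∪ : Meas (A ∪ B)) →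
             measure mA ≤ᵣ 0ᵣ → measure mB ≤ᵣ 0ᵣ → measure m∪ ≤ᵣ 0ᵣ
    null-∪ {A} {B} mA mB m∪ nullA nullB =
      nullA
      ∘ measure-∪-null mA mB∖A mA∪B∖A (λ (x , _ , ¬x) → contradiction x ¬x)
          (nullB ∘ measure-mono mB∖A mB proj₁)
      ∘ measure-mono m∪ mA∪B∖A split
      where
      mB∖A : Meas (B ∖ A)
      mB∖A = measurable-∖ mB mA

      mA∪B∖A : Meas (A ∪ (B ∖ A))
      mA∪B∖A = measurable-∪ mA mB∖A

      split : A ∪ B ⊆ A ∪ (B ∖ A)
      split (inj₁ x) = inj₁ x
      split {M} (inj₂ y) with em {_} {A M}
      ... | yes x = inj₁ x
      ... | no ¬x = inj₂ (y , ¬x)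

    measure≤1 : (mA : Meas A) → measure mA ≤ᵣ 1ᵣ
    measure≤1 {A} mA =
      proj₁ (total (compl measurable-∅) λ { M (() , _) })
      ∘ measure-mono mA (compl measurable-∅) λ { _ (() , _) }

    -- Almost disjoint families of events

    module _ {T : Set b} (E : T → Event) (mE : ∀ t → Meas (E t)) where

      AlmostDisjoint : T → T → Set
      AlmostDisjoint s t = measure (measurable-∩ (mE s) (mE t)) ≤ᵣ 0ᵣ

      private
        unionOf : List T → Event
        unionOf []       = ∅
        unionOf (t ∷ ts) = E t ∪ unionOf ts

        measurable-unionOf : ∀ ts → Meas (unionOf ts)
        measurable-unionOf []       = measurable-∅
        measurable-unionOf (t ∷ ts) = measurable-∪ (mE t) (measurable-unionOf ts)

        null-∩-unionOf : ∀ {t ts} → All (AlmostDisjoint t) ts →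
          measure (measurable-∩ (mE t) (measurable-unionOf ts)) ≤ᵣ 0ᵣ
        null-∩-unionOf {t} {[]} [] =
          empty⇒null (measurable-∩ (mE t) measurable-∅) λ { _ (_ , () , _) }
        null-∩-unionOf {t} {s ∷ ts} (h ∷ hs) =
          null-∪ mts mtts mst∪ h (null-∩-unionOf hs)
          ∘ measure-mono _ mst∪ (λ { (x , inj₁ y) → inj₁ (x , y)
                                   ; (x , inj₂ y) → inj₂ (x , y) })
          where
          mts  = measurable-∩ (mE t) (mE s)
          mtts = measurable-∩ (mE t) (measurable-unionOf ts)
          mst∪ = measurable-∪ mts mtts

      -- Removing from `E t` its null overlap with the later events keeps its measure and makes it
      -- disjoint from their union, so each event adds at least `r`.
      measure-unionOf : ∀ {r ts} → AllPairs AlmostDisjoint ts →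
        All (λ t → r ∈ Cut (measure (mE t))) ts →
        fromℚ (length ts · r) ≤ᵣ measure (measurable-unionOf ts)
      measure-unionOf [] [] = nonnegative measurable-∅
      measure-unionOf {r} {t ∷ ts} (h ∷ hs) (r∈ ∷ rs) {s} s<r+kr =
        measure-mono m∪ (measurable-unionOf (t ∷ ts))
          (λ { (inj₁ (x , _)) → inj₁ x ; (inj₂ y) → inj₂ y })
          (measure-superadditive mt∖ mts m∪ (λ ((_ , ¬y) , y) → contradiction y ¬y)
            -- A rational `s` below `r + k · r` splits as `r`, in the cut of the reduced event, plus
            -- `s - r`, which is below `k · r` and falls to the induction hypothesis.
            (r , s ℚ.- r ,
             measure-∖-null (mE t) mts (null-∩-unionOf h) r∈ ,
             measure-unionOf hs rs (p-q<r s<r+kr) ,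
             sym (p+[q-p]≡q r s)))
        where
        mts = measurable-unionOf ts
        mt∖ = measurable-∖ (mE t) mts
        m∪  = measurable-∪ mt∖ mts

      -- Since `measure-unionOf` gives a non-strict bound, `n + 1` events would yield only measure
      -- at least 1. One more raises the bound to `1 + 1/(n+1)`, which puts 1 into a cut contained
      -- in that of 1.
      almostDisjoint-bound : ∀ n {ts} → AllPairs AlmostDisjoint ts →
        All (λ t → unitFraction n ∈ Cut (measure (mE t))) ts → length ts ≢ 2 ℕ.+ n
      almostDisjoint-bound n {ts} disjoint large e =
        ℚ.<-irrefl refl (measure≤1 (measurable-unionOf ts)
          (measure-unionOf disjoint large 1<))
        where
        1< : 1ℚ ℚ.< length ts · unitFraction n
        1< = subst (λ k → 1ℚ ℚ.< k · unitFraction n) (sym e)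
          (subst (λ p → 1ℚ ℚ.< unitFraction n ℚ.+ p) (sym (n·unitFraction≡1 n))
            (subst (ℚ._< unitFraction n ℚ.+ 1ℚ) (ℚ.+-identityˡ 1ℚ)
              (ℚ.+-monoˡ-< 1ℚ (unitFraction-positive n))))

-- Antichains of codes of positive measure

positive⇒unitFraction∈ : ExcludedMiddle 0ℓ → ∀ x → 0ᵣ <ᵣ x →
                         ∃ λ n → unitFraction n ∈ Cut x
positive⇒unitFraction∈ em x (_ , x≰0) =
  let r , r∈x , r≮0 = decidable-stable (em {∃ λ r → r ∈ Cut x × ¬ r ℚ.< 0ℚ}) λ none →
        x≰0 λ {r} r∈x → decidable-stable (r ℚ.<? 0ℚ) λ r≮0 → none (r , r∈x , r≮0)
      -- Roundedness is used twice: `s` is strictly positive where `r` may be 0, and `t` gives the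
      -- strict inequality that `downwards` demands, as the unit fraction may equal `s`.
      s , r<s , s∈x = ℝ.rounded x r∈x
      n , u≤s       = unitFraction≤ (ℚ.≤-<-trans (ℚ.≮⇒≥ r≮0) r<s)
      t , s<t , t∈x = ℝ.rounded x s∈x
  in n , ℝ.downwards x (ℚ.≤-<-trans u≤s s<t) t∈x

proposition6p7 : (em : ∀ {a} → ExcludedMiddle a) →
    ∀ {ℓ} (X : Set ℓ) → Infinite X →
    (L : Language ℓ) (κ : Ordinal ℓ) (κ-infinite : Infinite (Ordinal.Carrier κ)) →
    (μ : ProbabilityMeasure X L κ) →
    CountableChainCondition (O⁺ X L κ em κ-infinite μ) (Below X L κ em κ-infinite μ) ℓ
proposition6p7 em X _ L κ κ-infinite μ S incompatible =
  boundedLayers⇒countable em (subsetoid P S)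
    (λ n t → unitFraction n ∈ Cut (measure (mE t))) (2 ℕ.+_)
    (λ n distinct → almostDisjoint-bound em X L κ κ-infinite μ E mE n
      (AllPairs.map (λ {s} {t} → distinct⇒almostDisjoint s t) distinct))
    (λ t@((_ , positive) , _) → positive⇒unitFraction∈ em (measure (mE t)) positive)
  where
  open ProbabilityMeasure μ
  open Ordinal κ using (_≟_)

  P = O⁺ X L κ em κ-infinite μ
  j₀ = i₀ X L κ em κ-infinite
  j₁ = i₁ X L κ em κ-infinite

  T : Set _
  T = Setoid.Carrier (subsetoid P S)

  E : T → Pred (Str L X) _
  E ((γ , _) , _) = Int X L κ γ

  mE : ∀ t → Measurable X L κ (E t)
  mE ((γ , _) , _) = measurable-Int X L κ em κ-infinite γ

  _∧_ : Code X L κ → Code X L κ → Code X L κ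
  _∧_ = _∧ᶜ_ X L κ em κ-infinite

  Int-∧ : ∀ γ ζ → Int X L κ (γ ∧ ζ) ≐ Int X L κ γ ∩ Int X L κ ζ
  Int-∧ γ ζ = to , from
    where
    to : Int X L κ (γ ∧ ζ) ⊆ Int X L κ γ ∩ Int X L κ ζ
    -- The index `j₀` selects `γ`, and `j₁`, being different from `j₀`, selects `ζ`.
    to h with j₀ ≟ j₀ | h j₀ | j₁ ≟ j₀ | h j₁
    ... | yes _   | x | no _     | y = x , y
    ... | no j≢j  | _ | _        | _ = contradiction refl j≢j
    ... | _       | _ | yes e   | _ = contradiction (sym e) (i₀≢i₁ X L κ em κ-infinite)

    from : Int X L κ γ ∩ Int X L κ ζ ⊆ Int X L κ (γ ∧ ζ)
    from (x , y) i with i ≟ j₀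
    ... | yes _ = x
    ... | no _  = y

  -- Inclusion of interpretations implies the forcing order, because the event of `γ ∧ (¬ᶜ ζ)` is
  -- then empty.
  null-∧¬ : ∀ γ ζ → Int X L κ γ ⊆ Int X L κ ζ →
            ⟦_⟧ X L κ em κ-infinite μ (γ ∧ (¬ᶜ ζ)) ≃ᵣ 0ᵣ
  null-∧¬ γ ζ γ⊆ζ =
    empty⇒null em X L κ κ-infinite μ (measurable-Int X L κ em κ-infinite (γ ∧ (¬ᶜ ζ)))
      (λ M h → let x , ¬y = proj₁ (Int-∧ γ (¬ᶜ ζ)) h in ¬y (γ⊆ζ x)) ,
    nonnegative _

  distinct⇒almostDisjoint : ∀ s t → ¬ Setoid._≈_ (subsetoid P S) s t →
    AlmostDisjoint em X L κ κ-infinite μ E mE s t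
  distinct⇒almostDisjoint s@((γ , γ⁺) , s∈S) t@((ζ , ζ⁺) , t∈S) s≉t =
    decidable-stable em λ not-null → incompatible s∈S t∈S s≉t
      -- Not being null is the strict half of positivity. `same` is needed because `not-null`
      -- concerns the intersection of the two events, which agrees with the interpretation of
      -- `γ ∧ ζ` only extensionally.
      ( (γ ∧ ζ , nonnegative _ , λ null → not-null (null ∘ proj₂ same))
      , null-∧¬ (γ ∧ ζ) γ (λ h → proj₁ (proj₁ (Int-∧ γ ζ) h))
      , null-∧¬ (γ ∧ ζ) ζ (λ h → proj₂ (proj₁ (Int-∧ γ ζ) h)))
    where
    same = measure-cong (measurable-Int X L κ em κ-infinite (γ ∧ ζ))
             (measurable-∩ em X L κ κ-infinite (mE s) (mE t)) (Int-∧ γ ζ)
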